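{- Let $G$ be a finite simple connected graph with normalized Laplacian $\mathcal{L}$ and Kemeny's constant $\mathcal{K}$, and let $\{x,y\}$ be a pair of distinct vertices of $G$ (an edge or a non-edge). Then the edge derivative of Kemeny's constant is bounded by $$\sum_{\lambda\neq 0}\left(\frac{ -2}{\lambda^2}\right)+\mathcal{K} \;\le\; \frac{d\mathcal{K}}{d\{x,y\}} \;\le\; \mathcal{K},$$ where the sum is over the nonzero eigenvalues $\lambda$ of $\mathcal{L}$, counted with multiplicity.
   Context: For a finite simple connected graph $G$ with at least two vertices, $A$ is the adjacency matrix, $d_x$ is the degree of the vertex $x$, $D$ is the diagonal matrix of degrees (invertible), and the normalized Laplacian is $\mathcal{L} = I - D^{ -1/2} A D^{ -1/2}$. Edge derivative of an eigenvalue: let $\lambda$ be an eigenvalue of $\mathcal{L}$ of multiplicity $k$, let $\mathbf{v}_1,\dots,\mathbf{v}_k$ be an orthonormal basis of the $\lambda$-eigenspace, and write $\mathbf{v}_{i,x}$ for the entry of $\mathbf{v}_i$ at the vertex $x$. For a pair $\{x,y\}$ of distinct vertices (adjacent or not), $$\frac{d\lambda}{d\{x,y\}} = \frac1k\sum_{i=1}^k\left[(1-\lambda)\left(\frac{\mathbf{v}_{i,x}^2}{d_x}+\frac{\mathbf{v}_{i,y}^2}{d_y}\right)-2\,\frac{\mathbf{v}_{i,x}\mathbf{v}_{i,y}}{\sqrt{d_xd_y}}\right].$$ This value does not depend on the choice of the orthonormal basis. Kemeny's constant of $G$ is $\mathcal{K}=\mathcal{K}(G)=\sum_{\lambda\ne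 0}\frac1\lambda$, the sum being over the nonzero eigenvalues of $\mathcal{L}$ counted with multiplicity, and its edge derivative is $$\frac{d\mathcal{K}}{d\{x,y\}}=\sum_{\lambda\neq 0}-\frac{1}{\lambda^2}\,\frac{d\lambda}{d\{x,y\}},$$ again over the nonzero eigenvalues counted with multiplicity. -}

module Defs where

open import Level using (Level; 0ℓ; _⊔_) renaming (suc to lsuc)
open import Algebra.Apartness.Bundles using (HeytingField; HeytingCommutativeRing)
open import Algebra.Bundles using (CommutativeRing)
open import Data.Bool.Base using (if_then_else_)
open import Data.Fin.Base using (Fin; zero; suc)
import Data.Fin.Properties as Fin
open import Data.List.Base using (List; []; _∷_; allFin; filter; length)
open import Data.List.Membership.Propositional using (_∈_)
open import Data.List.Membership.Propositional.Properties using (∈-allFin; ∈-filter⁺)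
open import Data.Nat.Base as ℕ using (ℕ; NonZero)
import Data.Nat.Properties as ℕₚ
open import Data.Product.Base using (Σ-syntax; ∃-syntax; _×_; _,_; proj₁; proj₂)
open import Data.Sum.Base using (_⊎_; inj₁; inj₂)
open import Data.Vec.Functional using (Vector)
open import Relation.Binary.Core using (Rel)
open import Relation.Binary.Construct.Closure.ReflexiveTransitive using (Star; ε; _◅_)
open import Relation.Binary.Definitions
  using (Cotransitive; Decidable; Irreflexive; Symmetric; Universal)
open import Relation.Binary.PropositionalEquality.Core as ≡ using (_≡_; _≢_)
open import Relation.Binary.Structures using (IsStrictPartialOrder)
open import Relation.Nullary.Decidable.Core using (does)
open import Relation.Nullary.Negation.Core using (¬_; contradiction)

private variable
  c ℓ₁ ℓ₂ : Level

record OrderedHeytingField c ℓ₁ ℓ₂ : Set (lsuc (c ⊔ ℓ₁ ⊔ ℓ₂)) where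
  field
    heytingField : HeytingField c ℓ₁ ℓ₂

  open HeytingField heytingField public

  infix 4 _<_ _≤_
  field
    _<_                  : Rel Carrier ℓ₂
    isStrictPartialOrder : IsStrictPartialOrder _≈_ _<_
    <-cotrans            : Cotransitive _<_
    <⇒#                  : ∀ {a b} → a < b → a # b
    #⇒<⊎>                : ∀ {a b} → a # b → a < b ⊎ b < a
    +-monoˡ-<            : ∀ {a b} d → a < b → a + d < b + d
    *-pos                : ∀ {a b} → 0# < a → 0# < b → 0# < a * b

  _≤_ : Rel Carrier ℓ₂
  a ≤ b = ¬ (b < a)

  open HeytingCommutativeRing heytingCommutativeRing public using (commutativeRing)
  open CommutativeRing commutativeRing public using (+-rawMonoid; semiring; ring)
  open import Algebra.Definitions.RawMonoid +-rawMonoid public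
    using () renaming (_×_ to _⋆_)

  -- The image of a natural number in the field; m ⋆ a is the m-fold sum of a.
  ι : ℕ → Carrier
  ι m = m ⋆ 1#

  -- |a m - a n| < e and |a n - l| < e, written without absolute values; in the
  -- first only one inequality is needed, by symmetry in m and n.
  IsCauchy : (ℕ → Carrier) → Set (c ⊔ ℓ₂)
  IsCauchy a = ∀ e → 0# < e →
    ∃[ N ] ∀ m n → N ℕ.≤ m → N ℕ.≤ n → a m < a n + e

  _ConvergesTo_ : (ℕ → Carrier) → Carrier → Set (c ⊔ ℓ₂)
  a ConvergesTo l = ∀ e → 0# < e →
    ∃[ N ] ∀ n → N ℕ.≤ n → (a n < l + e) × (l < a n + e)

-- The real numbers, given by their axioms: a Cauchy complete Archimedean
-- ordered field.  The axioms are those of constructive analysis, with _#_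
-- playing the role of ≠; classically they determine ℝ up to unique isomorphism.
-- Square roots follow from the other axioms; they are a field of the record
-- only so that they need not be constructed here.

record RealNumbers c ℓ₁ ℓ₂ : Set (lsuc (c ⊔ ℓ₁ ⊔ ℓ₂)) where
  field
    orderedHeytingField : OrderedHeytingField c ℓ₁ ℓ₂

  open OrderedHeytingField orderedHeytingField public

  field
    archimedean : ∀ a → ∃[ m ] a < ι m
    complete    : ∀ a → IsCauchy a → ∃[ l ] a ConvergesTo l
    sqrt        : ∀ a → 0# ≤ a → ∃[ r ] (0# ≤ r) × (r * r ≈ a)

record ConnectedGraph (n : ℕ) : Set₁ where
  infix 4 _~_ _~?_
  field
    2≤n       : 2 ℕ.≤ n
    _~_       : Rel (Fin n) 0ℓ
    _~?_      : Decidable _~_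
    symmetric : Symmetric _~_
    loopless  : Irreflexive _≡_ _~_
    connected : Universal (Star _~_)

  deg : Fin n → ℕ
  deg x = length (filter (x ~?_) (allFin n))

module _ {n} (G : ConnectedGraph n) where
  open ConnectedGraph G

  private
    length-nonZero : ∀ {A : Set} {a : A} {as : List A} → a ∈ as → NonZero (length as)
    length-nonZero {as = _ ∷ _} _ = _

    other : ∀ {m} → 2 ℕ.≤ m → (x : Fin m) → ∃[ y ] x ≢ y
    other (ℕ.s≤s (ℕ.s≤s _)) zero    = suc zero , λ ()
    other (ℕ.s≤s (ℕ.s≤s _)) (suc _) = zero , λ ()

    neighbour : ∀ {x y} → x ≢ y → Star _~_ x y → ∃[ z ] x ~ z
    neighbour x≢x ε         = contradiction ≡.refl x≢x
    neighbour _   (x~z ◅ _) = _ , x~z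

  deg-nonZero : ∀ x → NonZero (deg x)
  deg-nonZero x with other 2≤n x
  ... | y , x≢y with neighbour x≢y (connected x y)
  ...   | z , x~z = length-nonZero (∈-filter⁺ (x ~?_) (∈-allFin z) x~z)

module Real (ℝ : RealNumbers c ℓ₁ ℓ₂) where
  open RealNumbers ℝ
  open import Algebra.Apartness.Properties.HeytingCommutativeRing heytingCommutativeRing
    using (1#0; x-0≈x; x#0y#0→xy#0; invertibleʳ⇒#)
  open import Algebra.Properties.Ring ring
    using (-‿distribˡ-*; -‿involutive)
  open import Algebra.Properties.Semiring.Sum semiring public using (sum)

  private
    module < = IsStrictPartialOrder isStrictPartialOrder

  0<1 : 0# < 1#
  0<1 with #⇒<⊎> 1#0
  ... | inj₂ 0<1 = 0<1
  ... | inj₁ 1<0 = <.<-respʳ-≈ -1*-1≈1 (*-pos 0<-1 0<-1)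
    where
    0<-1 : 0# < - 1#
    0<-1 = <.<-respˡ-≈ (-‿inverseʳ 1#)
             (<.<-respʳ-≈ (+-identityˡ (- 1#)) (+-monoˡ-< (- 1#) 1<0))
    -1*-1≈1 : - 1# * - 1# ≈ 1#
    -1*-1≈1 = trans (sym (-‿distribˡ-* 1# (- 1#)))
                (trans (-‿cong (*-identityˡ (- 1#))) (-‿involutive 1#))

  0≤ι : ∀ m → 0# ≤ ι m
  0<ι : ∀ m → 0# < ι (ℕ.suc m)
  0≤ι ℕ.zero    = <.irrefl refl
  0≤ι (ℕ.suc m) ι<0 = <.irrefl refl (<.trans (0<ι m) ι<0)
  0<ι m with <-cotrans 0<1 (ι (ℕ.suc m))
  ... | inj₁ 0<ι = 0<ι
  ... | inj₂ ι<1 = contradiction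
    (<.<-respˡ-≈ ι-1≈ι (<.<-respʳ-≈ (-‿inverseʳ 1#) (+-monoˡ-< (- 1#) ι<1)))
    (0≤ι m)
    where
    ι-1≈ι : (1# + ι m) + - 1# ≈ ι m
    ι-1≈ι = trans (+-congʳ (+-comm 1# (ι m)))
              (trans (+-assoc (ι m) 1# (- 1#))
                (trans (+-congˡ (-‿inverseʳ 1#)) (+-identityʳ (ι m))))

  -- The library inverts a - 0# here, which is ≈ but not definitionally equal to a.
  infix 9 1/_
  1/_ : ∀ {a} → a # 0# → Carrier
  1/ a#0 = proj₁ (#⇒invertible a#0)

  ι#0 : ∀ m → .{{NonZero m}} → ι m # 0#
  ι#0 (ℕ.suc m) = #-sym (<⇒# (0<ι m))

  -- Only square roots of natural numbers (products of degrees) are needed.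
  √ : ℕ → Carrier
  √ m = proj₁ (sqrt (ι m) (0≤ι m))

  √#0 : ∀ m → .{{NonZero m}} → √ m # 0#
  √#0 m = invertibleʳ⇒# (√ m * 1/ (ι#0 m) ,
    trans (*-congʳ (x-0≈x (√ m)))
      (trans (sym (*-assoc (√ m) (√ m) _))
        (trans (*-congʳ (trans (proj₂ (proj₂ (sqrt (ι m) (0≤ι m)))) (sym (x-0≈x (ι m)))))
          (proj₂ (proj₂ (#⇒invertible (ι#0 m)))))))

  square#0 : ∀ {a} → a # 0# → a * a # 0#
  square#0 a#0 = x#0y#0→xy#0 a#0 a#0

  Matrix : ℕ → Set c
  Matrix n = Fin n → Fin n → Carrier

  I : ∀ {n} → Matrix n
  I x y = if does (x Fin.≟ y) then 1# else 0#

  diag : ∀ {n} → Vector Carrier n → Matrix n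
  diag v x y = if does (x Fin.≟ y) then v x else 0#

  infixl 7 _⊗_
  _⊗_ : ∀ {n} → Matrix n → Matrix n → Matrix n
  (M ⊗ N) x y = sum (λ z → M x z * N z y)

  infixl 6 _⊖_
  _⊖_ : ∀ {n} → Matrix n → Matrix n → Matrix n
  (M ⊖ N) x y = M x y - N x y

  ⟨_,_⟩ : ∀ {n} → Vector Carrier n → Vector Carrier n → Carrier
  ⟨ v , w ⟩ = sum (λ x → v x * w x)

  InEigenspace : ∀ {n} → Matrix n → Carrier → Vector Carrier n → Set ℓ₁
  InEigenspace M μ v = ∀ x → ⟨ M x , v ⟩ ≈ μ * v x

  IsEigenvalue : ∀ {n} → Matrix n → Carrier → Set (c ⊔ ℓ₁ ⊔ ℓ₂)
  IsEigenvalue {n} M μ = Σ[ v ∈ Vector Carrier n ] (∃[ x ] v x # 0#) × InEigenspace M μ v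

  record OrthonormalEigenbasis {n} (M : Matrix n) (μ : Carrier) (k : ℕ)
         : Set (c ⊔ ℓ₁) where
    field
      vec         : Fin k → Vector Carrier n
      inspace     : ∀ i → InEigenspace M μ (vec i)
      orthonormal : ∀ i j → ⟨ vec i , vec j ⟩ ≈ I i j
      spanning    : ∀ w → InEigenspace M μ w →
                    Σ[ a ∈ Vector Carrier k ] ∀ x → w x ≈ sum (λ i → a i * vec i x)

  -- The nonzero part of the spectrum of a symmetric matrix: a list of all the
  -- nonzero eigenvalues, each occurring once, together with their
  -- multiplicities (the dimensions of the eigenspaces) and a choice of
  -- orthonormal basis of each eigenspace.
  record NonzeroSpectrum {n} (M : Matrix n) : Set (c ⊔ ℓ₁ ⊔ ℓ₂) where
    field
      size         : ℕ
      eig          : Fin size → Carrier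
      eig#0        : ∀ j → eig j # 0#
      distinct     : ∀ i j → i ≢ j → eig i # eig j
      exhaustive   : ∀ μ → IsEigenvalue M μ → μ # 0# → ∃[ j ] μ ≈ eig j
      mult         : Fin size → ℕ
      mult-nonZero : ∀ j → NonZero (mult j)
      basis        : ∀ j → OrthonormalEigenbasis M (eig j) (mult j)

    -- Sum over the nonzero eigenvalues, counted with multiplicity.
    ∑λ≠0 : (Fin size → Carrier) → Carrier
    ∑λ≠0 f = sum (λ j → mult j ⋆ f j)

    1/λ 1/λ² : Fin size → Carrier
    1/λ  j = 1/ (eig#0 j)
    1/λ² j = 1/ (square#0 (eig#0 j))

    ∑-2/λ² kemeny : Carrier
    ∑-2/λ² = ∑λ≠0 (λ j → - ι 2 * 1/λ² j)
    kemeny = ∑λ≠0 1/λ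

  module _ {n} (G : ConnectedGraph n) where
    open ConnectedGraph G

    private instance
      deg≢0 : ∀ {x} → NonZero (deg x)
      deg≢0 {x} = deg-nonZero G x

      deg*deg≢0 : ∀ {x y} → NonZero (deg x ℕ.* deg y)
      deg*deg≢0 {x} {y} = ℕₚ.m*n≢0 (deg x) (deg y)

    adjacency : Matrix n
    adjacency x y = if does (x ~? y) then 1# else 0#

    D^-½ : Matrix n
    D^-½ = diag (λ x → 1/ (√#0 (deg x)))

    normalizedLaplacian : Matrix n
    normalizedLaplacian = I ⊖ (D^-½ ⊗ adjacency ⊗ D^-½)

    eigenvalueDerivative : ∀ {μ k} → .{{NonZero k}} →
      OrthonormalEigenbasis normalizedLaplacian μ k → Fin n → Fin n → Carrier
    eigenvalueDerivative {μ} {k} B x y = 1/ (ι#0 k) * sum λ i →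
        (1# - μ) * (vec i x * vec i x * 1/ (ι#0 (deg x))
                    + vec i y * vec i y * 1/ (ι#0 (deg y)))
        - ι 2 * (vec i x * vec i y * 1/ (√#0 (deg x ℕ.* deg y)))
      where open OrthonormalEigenbasis B

    kemenyDerivative : NonzeroSpectrum normalizedLaplacian → Fin n → Fin n → Carrier
    kemenyDerivative S x y = ∑λ≠0 λ j →
        - 1/λ² j * eigenvalueDerivative {{mult-nonZero j}} (basis j) x y
      where open NonzeroSpectrum S

-- The operations of a given field, for use where it is not opened.

infixl 6 add
add : (ℝ : RealNumbers c ℓ₁ ℓ₂) (a b : RealNumbers.Carrier ℝ) → RealNumbers.Carrier ℝ
add ℝ = RealNumbers._+_ ℝ
syntax add ℝ a b = a +[ ℝ ] b

infix 4 leq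
leq : (ℝ : RealNumbers c ℓ₁ ℓ₂) (a b : RealNumbers.Carrier ℝ) → Set ℓ₂
leq ℝ = RealNumbers._≤_ ℝ
syntax leq ℝ a b = a ≤[ ℝ ] b

{-# OPTIONS --safe #-}
module Submission where

-- Put f = D^{-1/2} v for a unit λ-eigenvector v.  Its contribution to dλ/d{x,y} is
-- t = (f x - f y)² - λ s with s = f x ² + f y ².  Here s ≤ 1, because all degrees are
-- at least 1, and 0 ≤ λ ≤ 2, because 2λ and 2(2 - λ) are the sums of (f x ∓ f y)² over
-- ordered pairs of adjacent vertices.  As 0 ≤ (f x - f y)² ≤ 2 s, it follows that
-- -λ ≤ t ≤ 2 - λ, hence -λ ≤ dλ/d{x,y} ≤ 2 - λ.  Multiplying by -1/λ² and summing over
-- the nonzero spectrum gives the theorem.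

open import Defs
open import Level using (Level; 0ℓ)
open import Algebra.Bundles using (CommutativeRing)
import Algebra.Properties.CommutativeMonoid.Mult as Mult
import Algebra.Properties.CommutativeSemigroup as CommutativeSemigroup
import Algebra.Properties.Ring as RingProperties
import Algebra.Properties.Semiring.Mult as SemiringMult
import Algebra.Properties.Semiring.Sum as SemiringSum
import Algebra.Apartness.Properties.HeytingCommutativeRing as HeytingProperties
open import Data.Bool.Base using (true; false; if_then_else_)
open import Data.Empty using (⊥)
open import Data.Nat.Base as ℕ using (ℕ; NonZero)
import Data.Nat.Properties as ℕₚ
open import Data.Fin.Base using (Fin; zero; suc)
import Data.Fin.Properties as Fin
open import Data.List.Base using (filter; length; tabulate)
open import Data.Product.Base using (_×_; _,_; proj₁; proj₂)
open import Data.Sum.Base using (inj₁; inj₂; [_,_]′)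
open import Data.Vec.Functional using (Vector)
open import Function.Base using (id; _∘_)
open import Function.Bundles using (mk⇔)
open import Relation.Binary.Bundles using (Preorder)
import Relation.Binary.Reasoning.Preorder as PreorderReasoning
open import Relation.Binary.PropositionalEquality.Core as ≡ using (_≡_; _≢_)
open import Relation.Binary.Structures using (IsStrictPartialOrder)
open import Relation.Nullary.Decidable using (does; dec-true; dec-false; does-⇔)
open import Relation.Nullary.Negation.Core using (contradiction)
open import Relation.Unary using (Pred; Decidable)

-- Inequalities, products and squares in an ordered Heyting field.

module OrderedField {c ℓ₁ ℓ₂ : Level} (F : OrderedHeytingField c ℓ₁ ℓ₂) where
  open OrderedHeytingField F hiding (zero)
  open CommutativeRing commutativeRing using (+-commutativeSemigroup)
  open RingProperties ring
    using (-‿distribˡ-*; -‿distribʳ-*; -‿involutive; -‿+-comm;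
           //-rightDividesˡ; //-rightDividesʳ)
  open HeytingProperties heytingCommutativeRing using (x-0≈x; invertibleʳ⇒#)
  open SemiringSum semiring using (sum; sum-cong-≋; sum-replicate-zero)
  private
    module < = IsStrictPartialOrder isStrictPartialOrder
    module +ₛ = CommutativeSemigroup +-commutativeSemigroup

  ≤-reflexive : ∀ {a b} → a ≈ b → a ≤ b
  ≤-reflexive a≈b = <.irrefl (sym a≈b)

  -- Since `≤` is the negation of the reversed `<`, cotransitivity does the work: a strict `d < a`
  -- must pass either above or below `b`.
  ≤-trans : ∀ {a b d} → a ≤ b → b ≤ d → a ≤ d
  ≤-trans {b = b} a≤b b≤d d<a with <-cotrans d<a b
  ... | inj₁ d<b = b≤d d<b
  ... | inj₂ b<a = a≤b b<a

  ≤-preorder : Preorder c ℓ₁ ℓ₂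
  ≤-preorder = record
    { _≈_ = _≈_ ; _≲_ = _≤_
    ; isPreorder = record
      { isEquivalence = <.isEquivalence ; reflexive = ≤-reflexive ; trans = ≤-trans } }

  module ≤-Reasoning = PreorderReasoning ≤-preorder
  open ≤-Reasoning

  <⇒≤ : ∀ {a b} → a < b → a ≤ b
  <⇒≤ a<b b<a = <.irrefl refl (<.trans a<b b<a)

  ≤-respˡ : ∀ {a b d} → a ≈ b → a ≤ d → b ≤ d
  ≤-respˡ a≈b a≤d d<b = a≤d (<.<-respʳ-≈ (sym a≈b) d<b)

  ≤-respʳ : ∀ {a b d} → a ≈ b → d ≤ a → d ≤ b
  ≤-respʳ a≈b d≤a b<d = d≤a (<.<-respˡ-≈ (sym a≈b) b<d)

  +-cancelʳ-< : ∀ {a b} d → a + d < b + d → a < b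
  +-cancelʳ-< {a} {b} d a+d<b+d =
    <.<-respˡ-≈ (//-rightDividesʳ d a)
      (<.<-respʳ-≈ (//-rightDividesʳ d b) (+-monoˡ-< (- d) a+d<b+d))

  +-monoˡ-≤ : ∀ {a b} d → a ≤ b → a + d ≤ b + d
  +-monoˡ-≤ d a≤b b+d<a+d = a≤b (+-cancelʳ-< d b+d<a+d)

  +-monoʳ-≤ : ∀ {a b} d → a ≤ b → d + a ≤ d + b
  +-monoʳ-≤ {a} {b} d a≤b = ≤-respˡ (+-comm a d) (≤-respʳ (+-comm b d) (+-monoˡ-≤ d a≤b))

  +-mono-≤ : ∀ {a b a′ b′} → a ≤ b → a′ ≤ b′ → a + a′ ≤ b + b′
  +-mono-≤ {b = b} {a′} a≤b a′≤b′ = ≤-trans (+-monoˡ-≤ a′ a≤b) (+-monoʳ-≤ b a′≤b′)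

  +-cancelʳ-≤ : ∀ {a b} d → a + d ≤ b + d → a ≤ b
  +-cancelʳ-≤ d a+d≤b+d b<a = a+d≤b+d (+-monoˡ-< d b<a)

  a≤a+b : ∀ {a b} → 0# ≤ b → a ≤ a + b
  a≤a+b {a} 0≤b = ≤-respˡ (+-identityʳ a) (+-monoʳ-≤ a 0≤b)

  +-nonNeg : ∀ {a b} → 0# ≤ a → 0# ≤ b → 0# ≤ a + b
  +-nonNeg 0≤a 0≤b = ≤-trans 0≤a (a≤a+b 0≤b)

  -- Halving without division: `b < a` would give `b + b < a + b < a + a`.
  a+a≤b+b⇒a≤b : ∀ {a b} → a + a ≤ b + b → a ≤ b
  a+a≤b+b⇒a≤b {a} {b} a+a≤b+b b<a = a+a≤b+b
    (<.trans (+-monoˡ-< b b<a) (<.<-respˡ-≈ (+-comm b a) (+-monoˡ-< a b<a)))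

  a<b⇒0<b-a : ∀ {a b} → a < b → 0# < b - a
  a<b⇒0<b-a {a} a<b = <.<-respˡ-≈ (-‿inverseʳ a) (+-monoˡ-< (- a) a<b)

  a≤b⇒0≤b-a : ∀ {a b} → a ≤ b → 0# ≤ b - a
  a≤b⇒0≤b-a {a} a≤b = ≤-respˡ (-‿inverseʳ a) (+-monoˡ-≤ (- a) a≤b)

  neg-antimono-≤ : ∀ {a b} → a ≤ b → - b ≤ - a
  neg-antimono-≤ {a} {b} a≤b = +-cancelʳ-≤ b (begin
    - b + b    ≈⟨ -‿inverseˡ b ⟩
    0#         ≲⟨ a≤b⇒0≤b-a a≤b ⟩
    b - a      ≈⟨ +-comm b (- a) ⟩
    - a + b    ∎)

  -- If `e` inverts `a * b`, then `b * e` inverts `a`, and an invertible element is apart from zero.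
  -- The differences with `0#` come from the form in which the field axioms state invertibility.
  *#0⇒#0 : ∀ {a b} → a * b # 0# → a # 0#
  *#0⇒#0 {a} {b} ab#0 with #⇒invertible ab#0
  ... | e , _ , ab-0*e≈1 = invertibleʳ⇒# (b * e , (begin-equality
    (a - 0#) * (b * e)  ≈⟨ *-congʳ (x-0≈x a) ⟩
    a * (b * e)         ≈⟨ *-assoc a b e ⟨
    a * b * e           ≈⟨ *-congʳ (x-0≈x (a * b)) ⟨
    (a * b - 0#) * e    ≈⟨ ab-0*e≈1 ⟩
    1#                  ∎))

  -- Signs are not decidable in general, but the goal is a negation: the assumption `a * b < 0#`
  -- makes both factors apart from zero, after which their signs can be compared. The same device
  -- proves `square-nonNeg`.
  *-nonNeg : ∀ {a b} → 0# ≤ a → 0# ≤ b → 0# ≤ a * b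
  *-nonNeg {a} {b} 0≤a 0≤b ab<0
    with #⇒<⊎> (*#0⇒#0 (<⇒# ab<0))
       | #⇒<⊎> (*#0⇒#0 (<⇒# (<.<-respˡ-≈ (*-comm a b) ab<0)))
  ... | inj₁ a<0 | _        = 0≤a a<0
  ... | inj₂ _   | inj₁ b<0 = 0≤b b<0
  ... | inj₂ 0<a | inj₂ 0<b = <.irrefl refl (<.trans ab<0 (*-pos 0<a 0<b))

  -a*-a≈a*a : ∀ a → - a * - a ≈ a * a
  -a*-a≈a*a a = begin-equality
    - a * - a      ≈⟨ -‿distribˡ-* a (- a) ⟨
    - (a * - a)    ≈⟨ -‿cong (-‿distribʳ-* a a) ⟨
    - - (a * a)    ≈⟨ -‿involutive (a * a) ⟩
    a * a          ∎

  square-nonNeg : ∀ a → 0# ≤ a * a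
  square-nonNeg a aa<0 with #⇒<⊎> (*#0⇒#0 (<⇒# aa<0))
  ... | inj₂ 0<a = <.irrefl refl (<.trans aa<0 (*-pos 0<a 0<a))
  ... | inj₁ a<0 = <.irrefl refl
    (<.trans aa<0 (<.<-respʳ-≈ (-a*-a≈a*a a) (*-pos 0<-a 0<-a)))
    where
    0<-a : 0# < - a
    0<-a = <.<-respʳ-≈ (+-identityˡ (- a)) (a<b⇒0<b-a a<0)

  *-monoʳ-≤ : ∀ {a b d} → 0# ≤ d → a ≤ b → d * a ≤ d * b
  *-monoʳ-≤ {a} {b} {d} 0≤d a≤b = begin
    d * a                ≲⟨ a≤a+b (*-nonNeg 0≤d (a≤b⇒0≤b-a a≤b)) ⟩
    d * a + d * (b - a)  ≈⟨ distribˡ d a (b - a) ⟨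
    d * (a + (b - a))    ≈⟨ *-congˡ (+-comm a (b - a)) ⟩
    d * (b - a + a)      ≈⟨ *-congˡ (//-rightDividesˡ a b) ⟩
    d * b                ∎

  *-monoˡ-≤ : ∀ {a b d} → 0# ≤ d → a ≤ b → a * d ≤ b * d
  *-monoˡ-≤ {a} {b} {d} 0≤d a≤b = ≤-respˡ (*-comm d a) (≤-respʳ (*-comm d b) (*-monoʳ-≤ 0≤d a≤b))

  -- By tightness it suffices to refute `a # b`, hence `a < b` and, symmetrically, `b < a`. The
  -- former would give `a * a ≤ a * b < b * b`.
  square-injective : ∀ {a b} → 0# ≤ a → 0# ≤ b → a * a ≈ b * b → a ≈ b
  square-injective {a} {b} 0≤a 0≤b aa≈bb = proj₁ (tight a b) λ a#b →
    [ a≮b 0≤a aa≈bb , a≮b 0≤b (sym aa≈bb) ]′ (#⇒<⊎> a#b)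
    where
    a≮b : ∀ {a b} → 0# ≤ a → a * a ≈ b * b → a < b → ⊥
    a≮b {a} {b} 0≤a aa≈bb a<b =
      *-monoʳ-≤ 0≤a (<⇒≤ a<b) (<.<-respʳ-≈ (sym aa≈bb) ab<bb)
      where
      0<b : 0# < b
      -- Comparing `0#` with the pair `a < b` makes `b` strictly positive, as `a` is not negative.
      0<b with <-cotrans a<b 0#
      ... | inj₁ a<0 = contradiction a<0 0≤a
      ... | inj₂ 0<b = 0<b
      ab<bb : a * b < b * b
      ab<bb = <.<-respˡ-≈ (+-identityˡ (a * b))
        (<.<-respʳ-≈ eq (+-monoˡ-< (a * b) (*-pos (a<b⇒0<b-a a<b) 0<b)))
        where
        eq : (b - a) * b + a * b ≈ b * b
        eq = trans (sym (distribʳ b (b - a) a)) (*-congʳ (//-rightDividesˡ a b))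

  square-+ : ∀ a b → (a + b) * (a + b) ≈ (a * a + b * b) + (a * b + a * b)
  square-+ a b = begin-equality
    (a + b) * (a + b)                  ≈⟨ distribʳ (a + b) a b ⟩
    a * (a + b) + b * (a + b)          ≈⟨ +-cong (distribˡ a a b) (trans (distribˡ b a b) (+-comm _ _)) ⟩
    a * a + a * b + (b * b + b * a)    ≈⟨ +ₛ.interchange (a * a) (a * b) (b * b) (b * a) ⟩
    a * a + b * b + (a * b + b * a)    ≈⟨ +-congˡ (+-congˡ (*-comm b a)) ⟩
    a * a + b * b + (a * b + a * b)    ∎

  0≤a²+b²+2ab : ∀ a b → 0# ≤ (a * a + b * b) + (a * b + a * b)
  0≤a²+b²+2ab a b = ≤-respʳ (square-+ a b) (square-nonNeg (a + b))

  -- This is nonnegativity of the square of `a - b`, read off from the previous lemma at `- b`.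
  2ab≤a²+b² : ∀ a b → a * b + a * b ≤ a * a + b * b
  2ab≤a²+b² a b = begin
    ab + ab                                      ≈⟨ +-identityˡ _ ⟨
    0# + (ab + ab)                               ≲⟨ +-monoˡ-≤ _ (0≤a²+b²+2ab a (- b)) ⟩
    a * a + - b * - b + (a * - b + a * - b) + (ab + ab)
                                                 ≈⟨ +-congʳ (+-cong (+-congˡ (-a*-a≈a*a b)) 2a[-b]≈) ⟩
    (a * a + b * b) - (ab + ab) + (ab + ab)      ≈⟨ //-rightDividesˡ (ab + ab) (a * a + b * b) ⟩
    a * a + b * b                                ∎
    where
    ab = a * b
    2a[-b]≈ : a * - b + a * - b ≈ - (ab + ab)
    2a[-b]≈ = trans (+-cong (sym (-‿distribʳ-* a b)) (sym (-‿distribʳ-* a b))) (-‿+-comm ab ab)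

  -- Finite sums and natural multiples.

  sum-mono : ∀ {n} {f g : Vector Carrier n} → (∀ i → f i ≤ g i) → sum f ≤ sum g
  sum-mono {ℕ.zero}  f≤g = ≤-reflexive refl
  sum-mono {ℕ.suc _} f≤g = +-mono-≤ (f≤g zero) (sum-mono (f≤g ∘ suc))

  sum-zero : ∀ {n} {f : Vector Carrier n} → (∀ i → f i ≈ 0#) → sum f ≈ 0#
  sum-zero {n} f≈0 = trans (sum-cong-≋ f≈0) (sum-replicate-zero n)

  sum-nonNeg : ∀ {n} {f : Vector Carrier n} → (∀ i → 0# ≤ f i) → 0# ≤ sum f
  sum-nonNeg {n} 0≤f = ≤-respˡ (sum-replicate-zero n) (sum-mono 0≤f)

  sum-single : ∀ {n} {f : Vector Carrier n} x → (∀ z → z ≢ x → f z ≈ 0#) → sum f ≈ f x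
  sum-single {f = f} zero f≈0 =
    trans (+-congˡ (sum-zero λ z → f≈0 (suc z) λ ())) (+-identityʳ (f zero))
  sum-single (suc x) f≈0 = trans
    (+-cong (f≈0 zero λ ()) (sum-single x λ z z≢x → f≈0 (suc z) (z≢x ∘ Fin.suc-injective)))
    (+-identityˡ _)

  term≤sum : ∀ {n} {f : Vector Carrier n} → (∀ i → 0# ≤ f i) → ∀ x → f x ≤ sum f
  term≤sum         0≤f zero    = a≤a+b (sum-nonNeg (0≤f ∘ suc))
  term≤sum {f = f} 0≤f (suc x) = begin
    f (suc x)                    ≲⟨ term≤sum (0≤f ∘ suc) x ⟩
    sum (f ∘ suc)                ≈⟨ +-identityˡ _ ⟨
    0# + sum (f ∘ suc)           ≲⟨ +-monoˡ-≤ _ (0≤f zero) ⟩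
    f zero + sum (f ∘ suc)       ∎

  -- The two indices are distinct, so `f x` and `f y` are separate terms of the sum, and the
  -- remaining terms only increase it.
  two-terms≤sum : ∀ {n} {f : Vector Carrier n} → (∀ i → 0# ≤ f i) →
                  ∀ {x y} → x ≢ y → f x + f y ≤ sum f
  two-terms≤sum 0≤f {zero} {zero} x≢y = contradiction ≡.refl x≢y
  two-terms≤sum {f = f} 0≤f {zero} {suc y} x≢y = +-monoʳ-≤ (f zero) (term≤sum (0≤f ∘ suc) y)
  two-terms≤sum {f = f} 0≤f {suc x} {zero} x≢y =
    ≤-respˡ (+-comm (f zero) (f (suc x))) (+-monoʳ-≤ (f zero) (term≤sum (0≤f ∘ suc) x))
  two-terms≤sum {f = f} 0≤f {suc x} {suc y} x≢y = begin
    f (suc x) + f (suc y)        ≲⟨ two-terms≤sum (0≤f ∘ suc) (x≢y ∘ ≡.cong suc) ⟩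
    sum (f ∘ suc)                ≈⟨ +-identityˡ _ ⟨
    0# + sum (f ∘ suc)           ≲⟨ +-monoˡ-≤ _ (0≤f zero) ⟩
    f zero + sum (f ∘ suc)       ∎

  ⋆-mono : ∀ m {a b} → a ≤ b → m ⋆ a ≤ m ⋆ b
  ⋆-mono ℕ.zero    a≤b = ≤-reflexive refl
  ⋆-mono (ℕ.suc m) a≤b = +-mono-≤ a≤b (⋆-mono m a≤b)

  ι*≈⋆ : ∀ m a → ι m * a ≈ m ⋆ a
  ι*≈⋆ m a = trans (SemiringMult.×-assoc-* semiring m 1# a)
                     (SemiringMult.×-congʳ semiring m (*-identityˡ a))

  sum-⋆ : ∀ k {a} → sum {k} (λ _ → a) ≈ k ⋆ a
  sum-⋆ = SemiringSum.sum-replicate semiring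

-- Reciprocals, square roots and averages.

module RealField {c ℓ₁ ℓ₂ : Level} (ℝ : RealNumbers c ℓ₁ ℓ₂) where
  open RealNumbers ℝ hiding (zero)
  open Real ℝ
  open OrderedField orderedHeytingField
  open ≤-Reasoning
  open RingProperties ring
    using (-‿distribˡ-*; -‿distribʳ-*; -‿involutive; -‿+-comm; //-rightDividesˡ)
  open HeytingProperties heytingCommutativeRing using (x-0≈x)
  open Mult (CommutativeRing.+-commutativeMonoid commutativeRing) using (×-distrib-+)
  open SemiringSum semiring using (sum-cong-≋; *-distribˡ-sum; *-distribʳ-sum; ∑-distrib-+; ∑-comm)
  private
    module < = IsStrictPartialOrder isStrictPartialOrder
    module +ₛ = CommutativeSemigroup (CommutativeRing.+-commutativeSemigroup commutativeRing)
    module *ₛ = CommutativeSemigroup (CommutativeRing.*-commutativeSemigroup commutativeRing)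

  *-1/ : ∀ {a} (a#0 : a # 0#) → a * 1/ a#0 ≈ 1#
  *-1/ {a} a#0 = trans (*-congʳ (sym (x-0≈x a))) (proj₂ (proj₂ (#⇒invertible a#0)))

  1/-unique : ∀ {a b} (a#0 : a # 0#) → a * b ≈ 1# → 1/ a#0 ≈ b
  1/-unique {a} {b} a#0 ab≈1 = begin-equality
    1/ a#0              ≈⟨ *-identityˡ _ ⟨
    1# * 1/ a#0         ≈⟨ *-congʳ ab≈1 ⟨
    a * b * 1/ a#0      ≈⟨ *ₛ.xy∙z≈xz∙y a b _ ⟩
    a * 1/ a#0 * b      ≈⟨ *-congʳ (*-1/ a#0) ⟩
    1# * b              ≈⟨ *-identityˡ b ⟩
    b                   ∎

  -- A reciprocal depends on a proof of apartness, so `d` carries its own and is tied to `a * b`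
  -- only by an equation. This covers both `ι (deg x)` as a product of square roots and the root of
  -- a product of degrees.
  1/-product : ∀ {a b d} (a#0 : a # 0#) (b#0 : b # 0#) (d#0 : d # 0#) → d ≈ a * b →
               1/ d#0 ≈ 1/ a#0 * 1/ b#0
  1/-product {a} {b} {d} a#0 b#0 d#0 d≈ab = 1/-unique d#0 (begin-equality
    d * (1/ a#0 * 1/ b#0)          ≈⟨ *-congʳ d≈ab ⟩
    a * b * (1/ a#0 * 1/ b#0)      ≈⟨ *ₛ.interchange a b _ _ ⟩
    a * 1/ a#0 * (b * 1/ b#0)      ≈⟨ *-cong (*-1/ a#0) (*-1/ b#0) ⟩
    1# * 1#                        ≈⟨ *-identityˡ 1# ⟩
    1#                             ∎)

  -- The reciprocal equals `a` times its own square.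
  1/-nonNeg : ∀ {a} (a#0 : a # 0#) → 0# ≤ a → 0# ≤ 1/ a#0
  1/-nonNeg {a} a#0 0≤a = begin
    0#                       ≲⟨ *-nonNeg 0≤a (square-nonNeg (1/ a#0)) ⟩
    a * (1/ a#0 * 1/ a#0)    ≈⟨ *-assoc a _ _ ⟨
    a * 1/ a#0 * 1/ a#0      ≈⟨ *-congʳ (*-1/ a#0) ⟩
    1# * 1/ a#0              ≈⟨ *-identityˡ _ ⟩
    1/ a#0                   ∎

  ι2*a≈a+a : ∀ a → ι 2 * a ≈ a + a
  ι2*a≈a+a a = trans (ι*≈⋆ 2 a) (+-congˡ (+-identityʳ a))

  √-square : ∀ m → √ m * √ m ≈ ι m
  √-square m = proj₂ (proj₂ (sqrt (ι m) (0≤ι m)))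

  √-nonNeg : ∀ m → 0# ≤ √ m
  √-nonNeg m = proj₁ (proj₂ (sqrt (ι m) (0≤ι m)))

  -- Both sides are nonnegative and have the square `ι (l ℕ.* m)`.
  √-* : ∀ l m → √ (l ℕ.* m) ≈ √ l * √ m
  √-* l m = square-injective
    (√-nonNeg (l ℕ.* m)) (*-nonNeg (√-nonNeg l) (√-nonNeg m)) (begin-equality
    √ (l ℕ.* m) * √ (l ℕ.* m)    ≈⟨ √-square (l ℕ.* m) ⟩
    ι (l ℕ.* m)                  ≈⟨ SemiringMult.×1-homo-* semiring l m ⟩
    ι l * ι m                    ≈⟨ *-cong (√-square l) (√-square m) ⟨
    √ l * √ l * (√ m * √ m)      ≈⟨ *ₛ.interchange (√ l) (√ l) (√ m) (√ m) ⟩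
    √ l * √ m * (√ l * √ m)      ∎)

  1≤ι : ∀ m → .{{NonZero m}} → 1# ≤ ι m
  1≤ι (ℕ.suc m) = a≤a+b (0≤ι m)

  1/k*[k⋆a]≈a : ∀ k .{{_ : NonZero k}} a → 1/ (ι#0 k) * (k ⋆ a) ≈ a
  1/k*[k⋆a]≈a k a = begin-equality
    1/ (ι#0 k) * (k ⋆ a)      ≈⟨ *-congˡ (ι*≈⋆ k a) ⟨
    1/ (ι#0 k) * (ι k * a)    ≈⟨ *ₛ.x∙yz≈yx∙z _ (ι k) a ⟩
    ι k * 1/ (ι#0 k) * a      ≈⟨ *-congʳ (*-1/ (ι#0 k)) ⟩
    1# * a                    ≈⟨ *-identityˡ a ⟩
    a                         ∎

  module _ (k : ℕ) .{{_ : NonZero k}} {t : Vector Carrier k} where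
    private
      1/k-nonNeg : 0# ≤ 1/ (ι#0 k)
      1/k-nonNeg = 1/-nonNeg (ι#0 k) (0≤ι k)

    average-≤ : ∀ {b} → (∀ i → t i ≤ b) → 1/ (ι#0 k) * sum t ≤ b
    average-≤ {b} t≤b = begin
      1/ (ι#0 k) * sum t      ≲⟨ *-monoʳ-≤ 1/k-nonNeg (sum-mono t≤b) ⟩
      1/ (ι#0 k) * sum (λ (_ : Fin k) → b)  ≈⟨ *-congˡ (sum-⋆ k) ⟩
      1/ (ι#0 k) * (k ⋆ b)    ≈⟨ 1/k*[k⋆a]≈a k b ⟩
      b                       ∎

    average-≥ : ∀ {b} → (∀ i → b ≤ t i) → b ≤ 1/ (ι#0 k) * sum t
    average-≥ {b} b≤t = begin
      b                       ≈⟨ 1/k*[k⋆a]≈a k b ⟨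
      1/ (ι#0 k) * (k ⋆ b)    ≈⟨ *-congˡ (sum-⋆ k) ⟨
      1/ (ι#0 k) * sum (λ (_ : Fin k) → b)  ≲⟨ *-monoʳ-≤ 1/k-nonNeg (sum-mono b≤t) ⟩
      1/ (ι#0 k) * sum t      ∎

  -- Diagonal matrices and counting.

  diag-≡ : ∀ {n} (v : Vector Carrier n) x → diag v x x ≈ v x
  diag-≡ v x rewrite dec-true (x Fin.≟ x) ≡.refl = refl

  diag-≢ : ∀ {n} (v : Vector Carrier n) {x y} → x ≢ y → diag v x y ≈ 0#
  diag-≢ v {x} {y} x≢y rewrite dec-false (x Fin.≟ y) x≢y = refl

  diag-⊗ : ∀ {n} (v : Vector Carrier n) M x y → (diag v ⊗ M) x y ≈ v x * M x y
  diag-⊗ v M x y = trans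
    (sum-single x λ z z≢x → trans (*-congʳ (diag-≢ v (z≢x ∘ ≡.sym))) (zeroˡ (M z y)))
    (*-congʳ (diag-≡ v x))

  ⊗-diag : ∀ {n} M (v : Vector Carrier n) x y → (M ⊗ diag v) x y ≈ M x y * v y
  ⊗-diag M v x y = trans
    (sum-single y λ z z≢y → trans (*-congˡ (diag-≢ v z≢y)) (zeroʳ (M x z)))
    (*-congˡ (diag-≡ v y))

  I-⟨⟩ : ∀ {n} (v : Vector Carrier n) x → ⟨ I x , v ⟩ ≈ v x
  I-⟨⟩ v x = trans
    -- `I` unfolds to the diagonal matrix of the constant vector `1#`, so the lemmas on `diag`
    -- apply.
    (sum-single x λ z z≢x → trans (*-congʳ (diag-≢ (λ _ → 1#) (z≢x ∘ ≡.sym))) (zeroˡ (v z)))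
    (trans (*-congʳ (diag-≡ (λ _ → 1#) x)) (*-identityˡ (v x)))

  -- Stated for `tabulate f` with arbitrary `f` so that the induction can pass to `f ∘ suc`; the
  -- list `allFin n` in the definition of the degree is the case `f = id`.
  ι-length-filter : ∀ {A : Set} {P : Pred A 0ℓ} (P? : Decidable P) {n} (f : Fin n → A) →
    ι (length (filter P? (tabulate f))) ≈ sum (λ i → if does (P? (f i)) then 1# else 0#)
  ι-length-filter P? {ℕ.zero}  f = refl
  ι-length-filter P? {ℕ.suc n} f with does (P? (f zero))
  ... | true  = +-congˡ (ι-length-filter P? (f ∘ suc))
  ... | false = trans (ι-length-filter P? (f ∘ suc)) (sym (+-identityˡ _))

  -- Sums over the nonzero spectrum.

  module _ {n : ℕ} {M : Matrix n} (S : NonzeroSpectrum M) where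
    open NonzeroSpectrum S

    ∑λ≠0-mono : ∀ {g h} → (∀ j → g j ≤ h j) → ∑λ≠0 g ≤ ∑λ≠0 h
    ∑λ≠0-mono g≤h = sum-mono λ j → ⋆-mono (mult j) (g≤h j)

    ∑λ≠0-+ : ∀ g h → ∑λ≠0 (λ j → g j + h j) ≈ ∑λ≠0 g + ∑λ≠0 h
    ∑λ≠0-+ g h = trans
      (sum-cong-≋ λ j → ×-distrib-+ (g j) (h j) (mult j))
      (∑-distrib-+ (λ j → mult j ⋆ g j) (λ j → mult j ⋆ h j))

    module _ (j : Fin size) where
      1/λ²≈1/λ*1/λ : 1/λ² j ≈ 1/λ j * 1/λ j
      1/λ²≈1/λ*1/λ = 1/-product (eig#0 j) (eig#0 j) (square#0 (eig#0 j)) refl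

      0≤1/λ² : 0# ≤ 1/λ² j
      0≤1/λ² = ≤-respʳ (sym 1/λ²≈1/λ*1/λ) (square-nonNeg (1/λ j))

      1/λ²*λ≈1/λ : 1/λ² j * eig j ≈ 1/λ j
      1/λ²*λ≈1/λ = begin-equality
        1/λ² j * eig j             ≈⟨ *-congʳ 1/λ²≈1/λ*1/λ ⟩
        1/λ j * 1/λ j * eig j      ≈⟨ *ₛ.xy∙z≈x∙zy (1/λ j) (1/λ j) (eig j) ⟩
        1/λ j * (eig j * 1/λ j)    ≈⟨ *-congˡ (*-1/ (eig#0 j)) ⟩
        1/λ j * 1#                 ≈⟨ *-identityʳ (1/λ j) ⟩
        1/λ j                      ∎

  -- Degrees and sums over adjacent pairs.

  module _ {n : ℕ} (G : ConnectedGraph n) where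
    open ConnectedGraph G

    private
      A L : Matrix n
      A = adjacency G
      L = normalizedLaplacian G

      -- The `NonZero` arguments of `ι#0` and `√#0` are irrelevant, so the reciprocals formed with
      -- these instances agree definitionally with those in the definition of the Laplacian.
      instance
        deg≢0 : ∀ {x} → NonZero (deg x)
        deg≢0 {x} = deg-nonZero G x

        deg*deg≢0 : ∀ {x y} → NonZero (deg x ℕ.* deg y)
        deg*deg≢0 {x} {y} = ℕₚ.m*n≢0 (deg x) (deg y)

      -- The diagonal of `D^-½`.
      r : Vector Carrier n
      r x = 1/ (√#0 (deg x))

    adjacency-sym : ∀ x y → A x y ≡ A y x
    adjacency-sym x y =
      ≡.cong (if_then 1# else 0#) (does-⇔ (mk⇔ symmetric symmetric) (x ~? y) (y ~? x))

    adjacency-nonNeg : ∀ x y → 0# ≤ A x y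
    adjacency-nonNeg x y with does (x ~? y)
    ... | true  = <⇒≤ 0<1
    ... | false = ≤-reflexive refl

    ι-deg : ∀ x → ι (deg x) ≈ sum (A x)
    ι-deg x = ι-length-filter (x ~?_) id

    1/deg : ∀ x → 1/ (ι#0 (deg x)) ≈ r x * r x
    1/deg x = 1/-product (√#0 (deg x)) (√#0 (deg x)) (ι#0 (deg x)) (sym (√-square (deg x)))

    1/√deg*deg : ∀ x y → 1/ (√#0 (deg x ℕ.* deg y)) ≈ r x * r y
    1/√deg*deg x y =
      1/-product (√#0 (deg x)) (√#0 (deg y)) (√#0 (deg x ℕ.* deg y)) (√-* (deg x) (deg y))

    D^-½⊗A⊗D^-½ : ∀ x y → (D^-½ G ⊗ A ⊗ D^-½ G) x y ≈ r x * A x y * r y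
    D^-½⊗A⊗D^-½ x y = trans (⊗-diag (D^-½ G ⊗ A) r x y) (*-congʳ (diag-⊗ r A x y))

    -- The sum of `h` over ordered pairs of adjacent vertices, so every edge is counted in both
    -- directions.
    ∑∑A : (Fin n → Fin n → Carrier) → Carrier
    ∑∑A h = sum λ x → sum λ y → A x y * h x y

    ∑∑A-mono : ∀ {g h} → (∀ x y → g x y ≤ h x y) → ∑∑A g ≤ ∑∑A h
    ∑∑A-mono g≤h = sum-mono λ x → sum-mono λ y → *-monoʳ-≤ (adjacency-nonNeg x y) (g≤h x y)

    ∑∑A-+ : ∀ g h → ∑∑A (λ x y → g x y + h x y) ≈ ∑∑A g + ∑∑A h
    ∑∑A-+ g h = trans
      (sum-cong-≋ λ x → trans (sum-cong-≋ λ y → distribˡ (A x y) (g x y) (h x y))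
                              (∑-distrib-+ (λ y → A x y * g x y) (λ y → A x y * h x y)))
      (∑-distrib-+ (λ x → sum λ y → A x y * g x y) (λ x → sum λ y → A x y * h x y))

    -- The row sums of the adjacency matrix are the degrees.
    ∑∑A-deg : ∀ (g : Vector Carrier n) → ∑∑A (λ x _ → g x) ≈ sum (λ x → ι (deg x) * g x)
    ∑∑A-deg g = sum-cong-≋ λ x →
      trans (sym (*-distribʳ-sum (g x) (A x))) (*-congʳ (sym (ι-deg x)))

    -- Exchange the two summations and use the symmetry of `A`.
    ∑∑A-swap : ∀ g → ∑∑A (λ x y → g y x) ≈ ∑∑A g
    ∑∑A-swap g = trans (∑-comm (λ x y → A x y * g y x))
      (sum-cong-≋ λ y → sum-cong-≋ λ x → *-congʳ (reflexive (adjacency-sym x y)))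

    -- A unit eigenvector and the bounds on its eigenvalue.

    module Eigenvector {μ : Carrier} {v : Vector Carrier n}
                       (Lv≈μv : InEigenspace L μ v) (unit : ⟨ v , v ⟩ ≈ 1#) where

      f : Vector Carrier n
      f x = v x * r x

      v²≈deg*f² : ∀ x → v x * v x ≈ ι (deg x) * (f x * f x)
      v²≈deg*f² x = sym (begin-equality
        ι (deg x) * (v x * r x * (v x * r x))         ≈⟨ *-congˡ (*ₛ.interchange (v x) (r x) (v x) (r x)) ⟩
        ι (deg x) * (v x * v x * (r x * r x))         ≈⟨ *-congˡ (*-congˡ (1/deg x)) ⟨
        ι (deg x) * (v x * v x * 1/ (ι#0 (deg x)))    ≈⟨ *ₛ.x∙yz≈y∙xz _ (v x * v x) _ ⟩
        v x * v x * (ι (deg x) * 1/ (ι#0 (deg x)))    ≈⟨ *-congˡ (*-1/ (ι#0 (deg x))) ⟩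
        v x * v x * 1#                                ≈⟨ *-identityʳ _ ⟩
        v x * v x                                     ∎)

      f²≤v² : ∀ x → f x * f x ≤ v x * v x
      f²≤v² x = begin
        f x * f x                  ≈⟨ *-identityˡ _ ⟨
        1# * (f x * f x)           ≲⟨ *-monoˡ-≤ (square-nonNeg (f x)) (1≤ι (deg x)) ⟩
        ι (deg x) * (f x * f x)    ≈⟨ v²≈deg*f² x ⟨
        v x * v x                  ∎

      f²+f²≤1 : ∀ {x y} → x ≢ y → f x * f x + f y * f y ≤ 1#
      f²+f²≤1 {x} {y} x≢y = begin
        f x * f x + f y * f y    ≲⟨ +-mono-≤ (f²≤v² x) (f²≤v² y) ⟩
        v x * v x + v y * v y    ≲⟨ two-terms≤sum (λ z → square-nonNeg (v z)) x≢y ⟩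
        ⟨ v , v ⟩                ≈⟨ unit ⟩
        1#                       ∎

      -- Each vertex contributes `f x * f x` once per neighbour, which adds up to `v x * v x`.
      ∑∑Af² : ∑∑A (λ x _ → f x * f x) ≈ 1#
      ∑∑Af² = begin-equality
        ∑∑A (λ x _ → f x * f x)                  ≈⟨ ∑∑A-deg (λ x → f x * f x) ⟩
        sum (λ x → ι (deg x) * (f x * f x))      ≈⟨ sum-cong-≋ v²≈deg*f² ⟨
        ⟨ v , v ⟩                                ≈⟨ unit ⟩
        1#                                       ∎

      ∑∑A[f²+f²] : ∑∑A (λ x y → f x * f x + f y * f y) ≈ 1# + 1#
      ∑∑A[f²+f²] = trans (∑∑A-+ _ _)
        (+-cong ∑∑Af² (trans (∑∑A-swap (λ x _ → f x * f x)) ∑∑Af²))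

      ∑∑Aff : Carrier
      ∑∑Aff = ∑∑A (λ x y → f x * f y)

      private
        N : Matrix n
        N = D^-½ G ⊗ A ⊗ D^-½ G

        -- The terms of the entry of `N` times `v` at `x`, with the entry of `N` written out.
        w : Fin n → Vector Carrier n
        w x y = r x * A x y * r y * v y

      -- As `L` is `I ⊖ N`, adding the image of `v` under `N` to that under `L` gives back `v`.
      eigen-equation : ∀ x → μ * v x + sum (w x) ≈ v x
      eigen-equation x = begin-equality
        μ * v x + sum (w x)                    ≈⟨ +-cong (Lv≈μv x) (sum-cong-≋ λ y → *-congʳ (D^-½⊗A⊗D^-½ x y)) ⟨
        ⟨ L x , v ⟩ + ⟨ N x , v ⟩              ≈⟨ ∑-distrib-+ (λ y → L x y * v y) (λ y → N x y * v y) ⟨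
        sum (λ y → L x y * v y + N x y * v y)  ≈⟨ sum-cong-≋ L+N≈I ⟩
        ⟨ I x , v ⟩                            ≈⟨ I-⟨⟩ v x ⟩
        v x                                    ∎
        where
        L+N≈I : ∀ y → L x y * v y + N x y * v y ≈ I x y * v y
        L+N≈I y = trans (sym (distribʳ (v y) (L x y) (N x y)))
                        (*-congʳ (//-rightDividesˡ (N x y) (I x y)))

      -- Take the inner product of the eigenvalue equation with `v`: the first term becomes `μ`
      -- because `v` is a unit vector, and the second is the quadratic form of `N` at `v`, which in
      -- terms of `f` is `∑∑Aff`.
      μ+∑∑Aff≈1 : μ + ∑∑Aff ≈ 1#
      μ+∑∑Aff≈1 = begin-equality
        μ + ∑∑Aff                                     ≈⟨ +-cong μ≈ ∑∑Aff≈ ⟩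
        ⟨ v , (λ x → μ * v x) ⟩ + ⟨ v , sum ∘ w ⟩     ≈⟨ ∑-distrib-+ (λ x → v x * (μ * v x)) _ ⟨
        sum (λ x → v x * (μ * v x) + v x * sum (w x)) ≈⟨ sum-cong-≋ (λ x → distribˡ (v x) _ _) ⟨
        sum (λ x → v x * (μ * v x + sum (w x)))       ≈⟨ sum-cong-≋ (λ x → *-congˡ (eigen-equation x)) ⟩
        ⟨ v , v ⟩                                     ≈⟨ unit ⟩
        1#                                            ∎
        where
        μ≈ : μ ≈ sum (λ x → v x * (μ * v x))
        μ≈ = begin-equality
          μ                               ≈⟨ *-identityʳ μ ⟨
          μ * 1#                          ≈⟨ *-congˡ unit ⟨
          μ * ⟨ v , v ⟩                   ≈⟨ *-distribˡ-sum μ (λ x → v x * v x) ⟩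
          sum (λ x → μ * (v x * v x))     ≈⟨ sum-cong-≋ (λ x → *ₛ.x∙yz≈y∙xz μ (v x) (v x)) ⟩
          sum (λ x → v x * (μ * v x))     ∎
        rearrange : ∀ x y → A x y * (f x * f y) ≈ v x * w x y
        rearrange x y = begin-equality
          A x y * (v x * r x * (v y * r y))    ≈⟨ *-congˡ (*-assoc (v x) (r x) (v y * r y)) ⟩
          A x y * (v x * (r x * (v y * r y)))  ≈⟨ *ₛ.x∙yz≈y∙xz (A x y) (v x) _ ⟩
          v x * (A x y * (r x * (v y * r y)))  ≈⟨ *-congˡ (*ₛ.x∙yz≈yx∙z (A x y) (r x) _) ⟩
          v x * (r x * A x y * (v y * r y))    ≈⟨ *-congˡ (*-congˡ (*-comm (v y) (r y))) ⟩
          v x * (r x * A x y * (r y * v y))    ≈⟨ *-congˡ (*-assoc _ (r y) (v y)) ⟨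
          v x * (r x * A x y * r y * v y)      ∎
        ∑∑Aff≈ : ∑∑Aff ≈ ⟨ v , sum ∘ w ⟩
        ∑∑Aff≈ = sum-cong-≋ λ x →
          trans (sum-cong-≋ (rearrange x)) (sym (*-distribˡ-sum (v x) (w x)))

      -- Since `∑∑Aff` is `1# - μ`, it must be shown to be at most one. Summing `2ab≤a²+b²` over
      -- adjacent pairs bounds its double by two.
      0≤eigenvalue : 0# ≤ μ
      0≤eigenvalue = +-cancelʳ-≤ ∑∑Aff (begin
        0# + ∑∑Aff    ≈⟨ +-identityˡ ∑∑Aff ⟩
        ∑∑Aff         ≲⟨ a+a≤b+b⇒a≤b ∑∑Aff+∑∑Aff≤2 ⟩
        1#            ≈⟨ μ+∑∑Aff≈1 ⟨
        μ + ∑∑Aff     ∎)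
        where
        ∑∑Aff+∑∑Aff≤2 : ∑∑Aff + ∑∑Aff ≤ 1# + 1#
        ∑∑Aff+∑∑Aff≤2 = begin
          ∑∑Aff + ∑∑Aff                              ≈⟨ ∑∑A-+ _ _ ⟨
          ∑∑A (λ x y → f x * f y + f x * f y)        ≲⟨ ∑∑A-mono (λ x y → 2ab≤a²+b² (f x) (f y)) ⟩
          ∑∑A (λ x y → f x * f x + f y * f y)        ≈⟨ ∑∑A[f²+f²] ⟩
          1# + 1#                                    ∎

      -- The gap between `μ` and two is `∑∑Aff + 1#`, and twice this gap is the sum of the squares
      -- of `f x + f y` over adjacent pairs.
      eigenvalue≤2 : μ ≤ 1# + 1#
      eigenvalue≤2 = begin
        μ                      ≲⟨ a≤a+b 0≤∑∑Aff+1 ⟩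
        μ + (∑∑Aff + 1#)       ≈⟨ +-assoc μ ∑∑Aff 1# ⟨
        μ + ∑∑Aff + 1#         ≈⟨ +-congʳ μ+∑∑Aff≈1 ⟩
        1# + 1#                ∎
        where
        0≤∑∑Aff+1 : 0# ≤ ∑∑Aff + 1#
        0≤∑∑Aff+1 = a+a≤b+b⇒a≤b (begin
          0# + 0#                                         ≈⟨ +-identityˡ 0# ⟩
          0#                                              ≲⟨ sum-nonNeg (λ x → sum-nonNeg (0≤Af²+f²+2ff x)) ⟩
          ∑∑A (λ x y → f²+f² x y + 2ff x y)               ≈⟨ ∑∑A-+ f²+f² 2ff ⟩
          ∑∑A f²+f² + ∑∑A 2ff                             ≈⟨ +-cong ∑∑A[f²+f²] (∑∑A-+ _ _) ⟩
          1# + 1# + (∑∑Aff + ∑∑Aff)                       ≈⟨ +ₛ.interchange 1# 1# ∑∑Aff ∑∑Aff ⟩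
          1# + ∑∑Aff + (1# + ∑∑Aff)                       ≈⟨ +-cong (+-comm 1# ∑∑Aff) (+-comm 1# ∑∑Aff) ⟩
          ∑∑Aff + 1# + (∑∑Aff + 1#)                       ∎)
          where
          f²+f² 2ff : Matrix n
          f²+f² x y = f x * f x + f y * f y
          2ff x y = f x * f y + f x * f y
          0≤Af²+f²+2ff : ∀ x y → 0# ≤ A x y * (f²+f² x y + 2ff x y)
          0≤Af²+f²+2ff x y = *-nonNeg (adjacency-nonNeg x y) (0≤a²+b²+2ab (f x) (f y))

      -- Bounds on the contribution of one eigenvector to the derivative.

      derivativeTerm : Fin n → Fin n → Carrier
      derivativeTerm x y =
        -- The expression repeats the summand of `eigenvalueDerivative` literally, so bounds on it
        -- pass to the average without rewriting.
        (1# - μ) * (v x * v x * 1/ (ι#0 (deg x)) + v y * v y * 1/ (ι#0 (deg y)))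
        - ι 2 * (v x * v y * 1/ (√#0 (deg x ℕ.* deg y)))

      module _ (x y : Fin n) where
        private
          t s p : Carrier
          t = derivativeTerm x y
          s = f x * f x + f y * f y
          p = f x * f y

        -- Equivalently, `t + μ * s` is `s - (p + p)`, the square of `f x - f y`; the additive form
        -- lets the next two bounds follow by cancellation.
        term+μs+2p≈s : t + μ * s + (p + p) ≈ s
        term+μs+2p≈s = begin-equality
          t + μ * s + (p + p)                          ≈⟨ +-congʳ (+-congʳ t≈) ⟩
          (1# - μ) * s - (p + p) + μ * s + (p + p)     ≈⟨ +-congʳ (+ₛ.xy∙z≈xz∙y _ (- (p + p)) (μ * s)) ⟩
          (1# - μ) * s + μ * s - (p + p) + (p + p)     ≈⟨ //-rightDividesˡ (p + p) _ ⟩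
          (1# - μ) * s + μ * s                         ≈⟨ distribʳ s (1# - μ) μ ⟨
          (1# - μ + μ) * s                             ≈⟨ *-congʳ (//-rightDividesˡ μ 1#) ⟩
          1# * s                                       ≈⟨ *-identityˡ s ⟩
          s                                            ∎
          where
          f²≈ : ∀ z → v z * v z * 1/ (ι#0 (deg z)) ≈ f z * f z
          f²≈ z = trans (*-congˡ (1/deg z)) (*ₛ.interchange (v z) (v z) (r z) (r z))
          s≈ : v x * v x * 1/ (ι#0 (deg x)) + v y * v y * 1/ (ι#0 (deg y)) ≈ s
          s≈ = +-cong (f²≈ x) (f²≈ y)
          p≈ : v x * v y * 1/ (√#0 (deg x ℕ.* deg y)) ≈ p
          p≈ = trans (*-congˡ (1/√deg*deg x y)) (*ₛ.interchange (v x) (v y) (r x) (r y))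
          t≈ : t ≈ (1# - μ) * s - (p + p)
          t≈ = +-cong (*-congˡ s≈) (-‿cong (trans (*-congˡ p≈) (ι2*a≈a+a p)))

        0≤term+μs : 0# ≤ t + μ * s
        0≤term+μs = +-cancelʳ-≤ (p + p) (begin
          0# + (p + p)             ≈⟨ +-identityˡ _ ⟩
          p + p                    ≲⟨ 2ab≤a²+b² (f x) (f y) ⟩
          s                        ≈⟨ term+μs+2p≈s ⟨
          t + μ * s + (p + p)      ∎)

        -- The difference of the two sides is the square of `f x + f y`.
        term+μs≤2s : t + μ * s ≤ s + s
        term+μs≤2s = begin
          t + μ * s                        ≲⟨ a≤a+b (0≤a²+b²+2ab (f x) (f y)) ⟩
          t + μ * s + (s + (p + p))        ≈⟨ +-congˡ (+-comm s (p + p)) ⟩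
          t + μ * s + ((p + p) + s)        ≈⟨ +-assoc _ _ s ⟨
          t + μ * s + (p + p) + s          ≈⟨ +-congʳ term+μs+2p≈s ⟩
          s + s                            ∎

        module _ (x≢y : x ≢ y) where
          private
            -- The slack in `f²+f²≤1`. It splits `μ` into `μ * s`, which completes the square in
            -- `t`, and `μ * u`, which is controlled by the bounds on `μ`.
            u : Carrier
            u = 1# - s

            s+u≈1 : s + u ≈ 1#
            s+u≈1 = trans (+-comm s u) (//-rightDividesˡ s 1#)

            0≤u : 0# ≤ u
            0≤u = a≤b⇒0≤b-a (f²+f²≤1 x≢y)

            term+μ≈ : t + μ ≈ t + μ * s + μ * u
            term+μ≈ = begin-equality
              t + μ                    ≈⟨ +-congˡ (*-identityʳ μ) ⟨
              t + μ * 1#               ≈⟨ +-congˡ (*-congˡ s+u≈1) ⟨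
              t + μ * (s + u)          ≈⟨ +-congˡ (distribˡ μ s u) ⟩
              t + (μ * s + μ * u)      ≈⟨ +-assoc t (μ * s) (μ * u) ⟨
              t + μ * s + μ * u        ∎

          -μ≤term : - μ ≤ t
          -μ≤term = +-cancelʳ-≤ μ (begin
            - μ + μ                   ≈⟨ -‿inverseˡ μ ⟩
            0#                        ≲⟨ +-nonNeg 0≤term+μs (*-nonNeg 0≤eigenvalue 0≤u) ⟩
            t + μ * s + μ * u         ≈⟨ term+μ≈ ⟨
            t + μ                     ∎)

          term≤2-μ : t ≤ ι 2 - μ
          term≤2-μ = +-cancelʳ-≤ μ (begin
            t + μ                     ≈⟨ term+μ≈ ⟩
            -- The bounds with factor two on both parts recombine, since `s + u` is one.
            t + μ * s + μ * u         ≲⟨ +-mono-≤ term+μs≤2s (*-monoˡ-≤ 0≤u eigenvalue≤2) ⟩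
            s + s + (1# + 1#) * u     ≈⟨ +-congˡ (*-congʳ (+-congˡ (+-identityʳ 1#))) ⟨
            s + s + ι 2 * u           ≈⟨ +-congˡ (ι2*a≈a+a u) ⟩
            s + s + (u + u)           ≈⟨ +ₛ.interchange s s u u ⟩
            s + u + (s + u)           ≈⟨ +-cong s+u≈1 s+u≈1 ⟩
            1# + 1#                   ≈⟨ +-congˡ (+-identityʳ 1#) ⟨
            ι 2                       ≈⟨ //-rightDividesˡ μ (ι 2) ⟨
            ι 2 - μ + μ               ∎)

    -- Averaging over an orthonormal eigenbasis.

    module _ {μ : Carrier} {k : ℕ} .{{_ : NonZero k}} (B : OrthonormalEigenbasis L μ k)
             {x y : Fin n} (x≢y : x ≢ y) where
      open OrthonormalEigenbasis B

      private
        unit : ∀ i → ⟨ vec i , vec i ⟩ ≈ 1#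
        unit i = trans (orthonormal i i) (diag-≡ (λ _ → 1#) i)

      -μ≤derivative : - μ ≤ eigenvalueDerivative G B x y
      -μ≤derivative = average-≥ k λ i → Eigenvector.-μ≤term (inspace i) (unit i) x y x≢y

      derivative≤2-μ : eigenvalueDerivative G B x y ≤ ι 2 - μ
      derivative≤2-μ = average-≤ k λ i → Eigenvector.term≤2-μ (inspace i) (unit i) x y x≢y

    -- Summation over the nonzero spectrum.

    module _ (S : NonzeroSpectrum L) {x y : Fin n} (x≢y : x ≢ y) where
      open NonzeroSpectrum S

      private
        dλ : Fin size → Carrier
        dλ j = eigenvalueDerivative G {{mult-nonZero j}} (basis j) x y

        module _ (j : Fin size) where
          -- Moving the sign onto the derivative leaves the nonnegative factor `1/λ² j`, by which
          -- inequalities can be multiplied. The sign exchanges the roles of the two bounds on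
          -- `dλ j`.
          -1/λ²*dλ≈ : - 1/λ² j * dλ j ≈ 1/λ² j * - dλ j
          -1/λ²*dλ≈ = trans (sym (-‿distribˡ-* _ _)) (-‿distribʳ-* _ _)

          -λ≤dλ : - eig j ≤ dλ j
          -λ≤dλ = -μ≤derivative {{mult-nonZero j}} (basis j) x≢y

          dλ≤2-λ : dλ j ≤ ι 2 - eig j
          dλ≤2-λ = derivative≤2-μ {{mult-nonZero j}} (basis j) x≢y

          term≤1/λ : - 1/λ² j * dλ j ≤ 1/λ j
          term≤1/λ = begin
            - 1/λ² j * dλ j        ≈⟨ -1/λ²*dλ≈ ⟩
            1/λ² j * - dλ j        ≲⟨ *-monoʳ-≤ (0≤1/λ² S j) (neg-antimono-≤ -λ≤dλ) ⟩
            1/λ² j * - - eig j     ≈⟨ *-congˡ (-‿involutive (eig j)) ⟩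
            1/λ² j * eig j         ≈⟨ 1/λ²*λ≈1/λ S j ⟩
            1/λ j                  ∎

          -2/λ²+1/λ≤term : - ι 2 * 1/λ² j + 1/λ j ≤ - 1/λ² j * dλ j
          -2/λ²+1/λ≤term = begin
            - ι 2 * 1/λ² j + 1/λ j               ≈⟨ +-cong (*-comm (1/λ² j) (- ι 2)) (1/λ²*λ≈1/λ S j) ⟨
            1/λ² j * - ι 2 + 1/λ² j * eig j      ≈⟨ distribˡ (1/λ² j) (- ι 2) (eig j) ⟨
            1/λ² j * (- ι 2 + eig j)             ≈⟨ *-congˡ (+-congˡ (-‿involutive (eig j))) ⟨
            1/λ² j * (- ι 2 - - eig j)           ≈⟨ *-congˡ (-‿+-comm (ι 2) (- eig j)) ⟩
            1/λ² j * - (ι 2 - eig j)             ≲⟨ *-monoʳ-≤ (0≤1/λ² S j) (neg-antimono-≤ dλ≤2-λ) ⟩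
            1/λ² j * - dλ j                      ≈⟨ -1/λ²*dλ≈ ⟨
            - 1/λ² j * dλ j                      ∎

      ∑-2/λ²+kemeny≤derivative : ∑-2/λ² + kemeny ≤ kemenyDerivative G S x y
      ∑-2/λ²+kemeny≤derivative = ≤-respˡ (∑λ≠0-+ S _ _) (∑λ≠0-mono S -2/λ²+1/λ≤term)

      derivative≤kemeny : kemenyDerivative G S x y ≤ kemeny
      derivative≤kemeny = ∑λ≠0-mono S term≤1/λ

open Real using (NonzeroSpectrum; normalizedLaplacian; kemenyDerivative)
open Real.NonzeroSpectrum using (kemeny; ∑-2/λ²)

theorem3p3 : {c ℓ₁ ℓ₂ : Level} (ℝ : RealNumbers c ℓ₁ ℓ₂) {n : ℕ} (G : ConnectedGraph n)
    (S : NonzeroSpectrum ℝ (normalizedLaplacian ℝ G)) (x y : Fin n) → x ≢ y →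
    (∑-2/λ² S +[ ℝ ] kemeny S ≤[ ℝ ] kemenyDerivative ℝ G S x y)
      × (kemenyDerivative ℝ G S x y ≤[ ℝ ] kemeny S)
theorem3p3 ℝ G S x y x≢y = ∑-2/λ²+kemeny≤derivative G S x≢y , derivative≤kemeny G S x≢y
  where open RealField ℝ
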